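{- The Jahangir graph $J_{2,3}$ is not greedy. Concretely, label $J_{2,3}$ as the 6-cycle $v_1v_2v_3v_4v_5v_6v_1$ together with a vertex $v_7$ adjacent to $v_1,v_3,v_5$. Then $f(J_{2,3})=8$, and for the distribution with $p(v_2)=p(v_6)=3$, $p(v_1)=p(v_7)=1$ and $p(v_3)=p(v_4)=p(v_5)=0$ (8 pebbles in total), no sequence of greedy pebbling moves with respect to the root $v_4$ places a pebble on $v_4$.
   Context: A pebbling distribution on a graph $G$ assigns a nonnegative integer number of pebbles to each vertex. A pebbling move removes two pebbles from a vertex and places one pebble on an adjacent vertex. The pebbling number $f(G)$ is the least $p$ such that, for every distribution of $p$ pebbles and every vertex $w$, some sequence of pebbling moves places a pebble on $w$. For the Jahangir graph $J_{n,m}$ ($m\ge 3$): it has $nm+1$ vertices, namely a cycle $C_{nm}$ plus one extra vertex adjacent to $m$ vertices of the cycle that are consecutively at distance $n$ from each other along the cycle. Given a root $w$, a pebbling move from $u$ to $v$ is greedy if $\mathrm{dist}(v,w)<\mathrm{dist}(u,w)$. A graph $G$ is greedy if, from every distribution of $f(G)$ pebbles and for every root $w$, one pebble can be moved to $w$ using only greedy pebbling moves. -}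

module Defs where

open import Data.Nat using (ℕ; suc; _+_; _*_; _∸_; _≤_; _<_; s≤s; NonZero)
open import Data.Nat.Properties using (1+n≢n; ≤-refl; m*n≡1⇒n≡1)
open import Data.Nat.Divisibility using (_∣_)
open import Data.Fin using (Fin; toℕ; splitAt)
open import Data.Fin.Patterns
open import Data.Vec using (Vec; []; _∷_; lookup; sum; _[_]%=_)
open import Data.List using (List; []; _∷_)
open import Data.Product using (_×_; _,_; ∃-syntax)
open import Data.Sum using (_⊎_; inj₁; inj₂; swap)
open import Data.Empty using (⊥)
open import Relation.Nullary using (¬_)
open import Relation.Binary.PropositionalEquality using (_≡_; sym; trans; cong; subst)
open import Relation.Binary.Construct.Closure.ReflexiveTransitive using (Star)

record Graph : Set₁ where
  field
    order      : ℕ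
    Adj        : Fin order → Fin order → Set
    Adj-sym    : ∀ {u v} → Adj u v → Adj v u
    Adj-irrefl : ∀ {u} → ¬ Adj u u

  Vertex : Set
  Vertex = Fin order

open Graph public

IsLeast : (ℕ → Set) → ℕ → Set
IsLeast P n = P n × (∀ k → P k → n ≤ k)

module _ (G : Graph) where

  data Walk : Vertex G → Vertex G → ℕ → Set where
    stop : ∀ {u} → Walk u u 0
    step : ∀ {u v w k} → Adj G u v → Walk v w k → Walk u w (suc k)

  -- dist(u, w) = d.  A relation, because no distance exists between
  -- different components.
  IsDist : Vertex G → Vertex G → ℕ → Set
  IsDist u w = IsLeast (Walk u w)

  Distribution : Set
  Distribution = Vec ℕ (order G)

  size : Distribution → ℕ
  size = sum

  pebble : Vertex G → Vertex G → Distribution → Distribution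
  pebble u v p = (p [ u ]%= (_∸ 2)) [ v ]%= suc

  data Move : Distribution → Distribution → Set where
    move : ∀ {p} u v → Adj G u v → 2 ≤ lookup p u → Move p (pebble u v p)

  -- If dist(u, w) is infinite then so is dist(v, w) for every neighbour v of u,
  -- so requiring both distances to exist excludes no greedy move.
  Closer : Vertex G → Vertex G → Vertex G → Set
  Closer w v u = ∃[ d ] ∃[ e ] (IsDist v w d × IsDist u w e × d < e)

  data GreedyMove (w : Vertex G) : Distribution → Distribution → Set where
    move : ∀ {p} u v → Adj G u v → Closer w v u → 2 ≤ lookup p u →
           GreedyMove w p (pebble u v p)

  Reachable : Distribution → Vertex G → Set
  Reachable p w = ∃[ q ] (Star Move p q × 1 ≤ lookup q w)

  GreedilyReachable : Distribution → Vertex G → Set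
  GreedilyReachable p w = ∃[ q ] (Star (GreedyMove w) p q × 1 ≤ lookup q w)

  -- f(G) = k.
  IsPebblingNumber : ℕ → Set
  IsPebblingNumber = IsLeast λ k → ∀ p → size p ≡ k → ∀ w → Reachable p w

  IsGreedy : Set
  IsGreedy = ∀ k → IsPebblingNumber k →
             ∀ p → size p ≡ k → ∀ w → GreedilyReachable p w

CycleSucc : ∀ {N} → Fin N → Fin N → Set
CycleSucc {N} i j = toℕ j ≡ suc (toℕ i) ⊎ (suc (toℕ i) ≡ N × toℕ j ≡ 0)

-- inj₁ i is the i-th vertex of the cycle of length n * m, inj₂ 0F the extra
-- vertex, joined to the m cycle vertices 0, n, 2n, …, (m - 1)n.
JahangirAdj : ∀ n m → Fin (n * m) ⊎ Fin 1 → Fin (n * m) ⊎ Fin 1 → Set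
JahangirAdj n m (inj₁ i) (inj₁ j) = CycleSucc i j ⊎ CycleSucc j i
JahangirAdj n m (inj₁ i) (inj₂ _) = n ∣ toℕ i
JahangirAdj n m (inj₂ _) (inj₁ j) = n ∣ toℕ j
JahangirAdj n m (inj₂ _) (inj₂ _) = ⊥

JahangirAdj-sym : ∀ n m x y → JahangirAdj n m x y → JahangirAdj n m y x
JahangirAdj-sym n m (inj₁ _) (inj₁ _) a = swap a
JahangirAdj-sym n m (inj₁ _) (inj₂ _) a = a
JahangirAdj-sym n m (inj₂ _) (inj₁ _) a = a

CycleSucc-irrefl : ∀ {N} (i : Fin N) → ¬ N ≡ 1 → ¬ CycleSucc i i
CycleSucc-irrefl i N≢1 (inj₁ e)       = 1+n≢n (sym e)
CycleSucc-irrefl i N≢1 (inj₂ (e , z)) = N≢1 (trans (sym e) (cong suc z))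

JahangirAdj-irrefl : ∀ n m → 3 ≤ m → ∀ x → ¬ JahangirAdj n m x x
JahangirAdj-irrefl n m 3≤m (inj₁ i) a = irr a
  where
  nm≢1 : ¬ n * m ≡ 1
  nm≢1 e with s≤s () ← subst (3 ≤_) (m*n≡1⇒n≡1 n m e) 3≤m

  irr : ¬ (CycleSucc i i ⊎ CycleSucc i i)
  irr (inj₁ s) = CycleSucc-irrefl i nm≢1 s
  irr (inj₂ s) = CycleSucc-irrefl i nm≢1 s

jahangir : ∀ n m → .{{NonZero n}} → 3 ≤ m → Graph
jahangir n m 3≤m = record
  { order      = n * m + 1
  ; Adj        = λ u v → JahangirAdj n m (splitAt (n * m) u) (splitAt (n * m) v)
  ; Adj-sym    = λ {u} {v} → JahangirAdj-sym n m (splitAt (n * m) u) (splitAt (n * m) v)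
  ; Adj-irrefl = λ {u} → JahangirAdj-irrefl n m 3≤m (splitAt (n * m) u)
  }

J₂,₃ : Graph
J₂,₃ = jahangir 2 3 ≤-refl

v₁ v₂ v₃ v₄ v₅ v₆ v₇ : Vertex J₂,₃
v₁ = 0F
v₂ = 1F
v₃ = 2F
v₄ = 3F
v₅ = 4F
v₆ = 5F
v₇ = 6F

edges : List (Vertex J₂,₃ × Vertex J₂,₃)
edges = (v₁ , v₂) ∷ (v₂ , v₃) ∷ (v₃ , v₄) ∷ (v₄ , v₅) ∷ (v₅ , v₆) ∷ (v₆ , v₁)
      ∷ (v₇ , v₁) ∷ (v₇ , v₃) ∷ (v₇ , v₅) ∷ []

p₀ : Distribution J₂,₃
p₀ = 1 ∷ 3 ∷ 0 ∷ 0 ∷ 0 ∷ 3 ∷ 1 ∷ []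

{-# OPTIONS --safe #-}

-- Lower bound on f: weigh the pebbles on u by ω(u) = 2^(3 − dist(u, v₄)).
-- Since ω at most doubles along an edge, no move increases the total weight;
-- as v₁ is at distance 3 from v₄, at least 2³ pebbles on v₁ are needed.
-- Upper bound: seven moves exhaust eight pebbles, so a depth-first search of
-- depth seven from each of the C(14,6) distributions decides reachability.
-- Greedy failure: in p₀ the single pebbles on v₁ and v₇ are stuck, since greedy
-- moves never feed v₁ and feed v₇ only from v₁; v₂ can send one pebble to v₃ and
-- v₆ one to v₅, after which every vertex carries at most one pebble.
module Submission where

open import Data.Bool using (Bool; true; T; _∧_; _∨_)
open import Data.Bool.ListAction using (any; all)
open import Data.Bool.Properties using (T-∧; T-∨; T-≡)
open import Data.Fin using (Fin; zero; suc; toℕ; splitAt)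
open import Data.Fin.Properties using (all?)
open import Data.List using (List; []; _∷_; map; concatMap; upTo; allFin)
open import Data.List.Membership.Propositional using (_∈_; find; lose)
open import Data.List.Membership.Propositional.Properties using (∈-map⁺; ∈-concatMap⁺; ∈-upTo⁺; ∈-allFin)
open import Data.List.Relation.Unary.All as All using (All)
open import Data.List.Relation.Unary.All.Properties using (all⁺)
open import Data.List.Relation.Unary.Any using (here)
open import Data.List.Relation.Unary.Any.Properties using (any⁻)
open import Data.Nat using (ℕ; zero; suc; _+_; _*_; _∸_; _≤_; _<_; _≤ᵇ_; _≟_; _≤?_; _<?_; s≤s)
open import Data.Nat.Divisibility using (_∣?_)
open import Data.Nat.Properties using (≤-refl; ≤-reflexive; ≤-trans; ≤-<-trans; <-≤-trans; <⇒≱; ≤ᵇ⇒≤; m≤m+n; m≤n+m; m≤m*n; m+n∸m≡n; +-identityʳ; +-monoˡ-≤; module ≤-Reasoning)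
open import Data.Nat.Tactic.RingSolver using (solve-∀)
open import Data.Product using (_×_; _,_; uncurry)
open import Data.Product.Properties using () renaming (≡-dec to ×-≡-dec)
open import Data.Sum using (_⊎_; inj₁; inj₂)
open import Data.Vec using (Vec; []; _∷_; lookup; sum; zipWith; _[_]%=_)
open import Data.Vec.Properties using () renaming (≡-dec to Vec-≡-dec)
open import Function using (_∘_)
open import Function.Bundles using (_⇔_; mk⇔; Equivalence)
open import Relation.Binary.Construct.Closure.ReflexiveTransitive using (Star; ε; _◅_)
open import Relation.Binary.PropositionalEquality using (_≡_; refl; sym; subst; module ≡-Reasoning)
open import Relation.Nullary using (¬_; Dec; no)
open import Relation.Nullary.Decidable using (from-yes; _×-dec_; _⊎-dec_; _→-dec_)
open import Defs
import Data.Fin.Properties as Fin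
import Data.List.Membership.DecPropositional as DecMembership

open Equivalence using (to; from)

-- Weights of pebble distributions.

weight : ∀ {n} → Vec ℕ n → Vec ℕ n → ℕ
weight ω p = sum (zipWith _*_ ω p)

weight-add : ∀ {n} (ω p : Vec ℕ n) v →
             weight ω (p [ v ]%= suc) ≡ lookup ω v + weight ω p
weight-add (a ∷ ω) (x ∷ p) zero = rearrange a x (weight ω p)
  where
  rearrange : ∀ a x s → a * suc x + s ≡ a + (a * x + s)
  rearrange = solve-∀
weight-add (a ∷ ω) (x ∷ p) (suc v) rewrite weight-add ω p v =
  rearrange (a * x) (lookup ω v) (weight ω p)
  where
  rearrange : ∀ y b s → y + (b + s) ≡ b + (y + s)
  rearrange = solve-∀

-- The two pebbles appear as a summand on the left, so that no weights are subtracted;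
-- `2 ≤ lookup p u` makes the truncated `_∸ 2` exact.
weight-remove : ∀ {n} (ω p : Vec ℕ n) u → 2 ≤ lookup p u →
                2 * lookup ω u + weight ω (p [ u ]%= (_∸ 2)) ≡ weight ω p
weight-remove (a ∷ ω) (suc (suc x) ∷ p) zero _ = rearrange a x (weight ω p)
  where
  rearrange : ∀ a x s → 2 * a + (a * x + s) ≡ a * suc (suc x) + s
  rearrange = solve-∀
weight-remove (_ ∷ _) (suc zero ∷ _) zero (s≤s ())
weight-remove (a ∷ ω) (x ∷ p) (suc u) 2≤pu rewrite sym (weight-remove ω p u 2≤pu) =
  rearrange (a * x) (lookup ω u) (weight ω (p [ u ]%= (_∸ 2)))
  where
  rearrange : ∀ y b s → 2 * b + (y + s) ≡ y + (2 * b + s)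
  rearrange = solve-∀

lookup≤weight : ∀ {n} (ω p : Vec ℕ n) w → 1 ≤ lookup p w → lookup ω w ≤ weight ω p
lookup≤weight (a ∷ ω) (suc x ∷ p) zero    _    = ≤-trans (m≤m*n a (suc x)) (m≤m+n _ _)
lookup≤weight (a ∷ ω) (x ∷ p)     (suc w) 1≤pw = ≤-trans (lookup≤weight ω p w 1≤pw) (m≤n+m _ _)

module _ (G : Graph) where

  module _ (ω : Vec ℕ (order G))
           (ω-doubling : ∀ u v → Adj G u v → lookup ω v ≤ 2 * lookup ω u) where

    weight-move : ∀ {p q} → Move G p q → weight ω q ≤ weight ω p
    weight-move (move {p} u v uv 2≤pu) = begin
      weight ω (pebble G u v p)                          ≡⟨ weight-add ω (p [ u ]%= (_∸ 2)) v ⟩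
      lookup ω v + weight ω (p [ u ]%= (_∸ 2))           ≤⟨ +-monoˡ-≤ _ (ω-doubling u v uv) ⟩
      2 * lookup ω u + weight ω (p [ u ]%= (_∸ 2))       ≡⟨ weight-remove ω p u 2≤pu ⟩
      weight ω p                                         ∎
      where open ≤-Reasoning

    weight-moves : ∀ {p q} → Star (Move G) p q → weight ω q ≤ weight ω p
    weight-moves ε        = ≤-refl
    weight-moves (m ◅ ms) = ≤-trans (weight-moves ms) (weight-move m)

    reachable⇒≤weight : ∀ {p w} → Reachable G p w → lookup ω w ≤ weight ω p
    reachable⇒≤weight {w = w} (q , ms , 1≤qw) =
      ≤-trans (lookup≤weight ω q w 1≤qw) (weight-moves ms)

  module _ (w : Vertex G) (δ : Vertex G → ℕ) (δ-root : δ w ≡ 0)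
           (δ-lipschitz : ∀ u v → Adj G u v → δ u ≤ suc (δ v)) where

    δ≤length : ∀ {u k} → Walk G u w k → δ u ≤ k
    δ≤length stop                  = ≤-reflexive δ-root
    δ≤length (step {u} {v} uv v↝w) = ≤-trans (δ-lipschitz u v uv) (s≤s (δ≤length v↝w))

    -- The chain is `δ v ≤ d < e ≤ δ u`: the Lipschitz bound applies to the walk from `v`, and
    -- minimality of `e` to the given walk from `u`. Thus a numerical comparison replaces the
    -- existential `Closer`.
    closer⇒δ< : (∀ u → Walk G u w (δ u)) → ∀ {u v} → Closer G w v u → δ v < δ u
    closer⇒δ< walk {u} (d , e , (v↝w , _) , (_ , e-least) , d<e) =
      ≤-<-trans (δ≤length v↝w) (<-≤-trans d<e (e-least _ (walk u)))

  module _ (arcs : List (Vertex G × Vertex G)) (w : Vertex G) where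

    reaches : ℕ → Distribution G → Bool
    reaches zero    p = 1 ≤ᵇ lookup p w
    reaches (suc k) p = (1 ≤ᵇ lookup p w)
      ∨ any (λ (u , v) → (2 ≤ᵇ lookup p u) ∧ reaches k (pebble G u v p)) arcs

    -- The search itself is Boolean, so it can be run by evaluation; the sequence of moves is
    -- recovered here from the arcs that succeeded.
    reaches-sound : All (uncurry (Adj G)) arcs →
                    ∀ k p → T (reaches k p) → Reachable G p w
    reaches-sound adj zero    p t = p , ε , ≤ᵇ⇒≤ 1 _ t
    reaches-sound adj (suc k) p t with to T-∨ t
    ... | inj₁ t′ = p , ε , ≤ᵇ⇒≤ 1 _ t′
    ... | inj₂ t′ with (u , v) , uv∈arcs , t″ ← find (any⁻ _ arcs t′)
                  with 2≤pu , tail ← to (T-∧ {2 ≤ᵇ lookup p u}) t″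
                  with q , ms , 1≤qw ← reaches-sound adj k (pebble G u v p) tail =
      q , move u v (All.lookup adj uv∈arcs) (≤ᵇ⇒≤ 2 _ 2≤pu) ◅ ms , 1≤qw

-- Enumeration of all distributions of a given size.

compositions : ∀ n → ℕ → List (Vec ℕ n)
compositions zero    zero    = [] ∷ []
compositions zero    (suc _) = []
compositions (suc n) k       =
  concatMap (λ i → map (i ∷_) (compositions n (k ∸ i))) (upTo (suc k))

∈-compositions : ∀ {n} (p : Vec ℕ n) → p ∈ compositions n (sum p)
∈-compositions []      = here refl
∈-compositions {suc n} (x ∷ p) =
  ∈-concatMap⁺ (λ i → map (i ∷_) (compositions n (x + sum p ∸ i)))
    (lose (∈-upTo⁺ (s≤s (m≤m+n x (sum p))))
      (∈-map⁺ (x ∷_) (subst (λ k → p ∈ compositions n k) (sym (m+n∸m≡n x (sum p)))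
                             (∈-compositions p))))

-- Hypothesis and conclusion have the same shape, so nested checks compose: first over roots, then
-- over distributions.
all-sound : ∀ {A : Set} (f : A → Bool) xs → all f xs ≡ true → ∀ {x} → x ∈ xs → f x ≡ true
all-sound f xs eq = to T-≡ ∘ All.lookup (all⁺ f xs (from T-≡ eq))

-- The size `k` stays a variable so that matching on `refl` can replace it by `sum p`; with a
-- literal such as 8 the unification would be stuck.
all-sound-compositions : ∀ {n} (f : Vec ℕ n → Bool) k → all f (compositions n k) ≡ true →
                         ∀ p → sum p ≡ k → f p ≡ true
all-sound-compositions f _ eq p refl = all-sound f _ eq (∈-compositions p)

-- Deciding adjacency, and the edge list.

cycleSucc? : ∀ {N} (i j : Fin N) → Dec (CycleSucc i j)
cycleSucc? {N} i j = (toℕ j ≟ suc (toℕ i)) ⊎-dec ((suc (toℕ i) ≟ N) ×-dec (toℕ j ≟ 0))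

jahangirAdj? : ∀ n m x y → Dec (JahangirAdj n m x y)
jahangirAdj? n m (inj₁ i) (inj₁ j) = cycleSucc? i j ⊎-dec cycleSucc? j i
jahangirAdj? n m (inj₁ i) (inj₂ _) = n ∣? toℕ i
jahangirAdj? n m (inj₂ _) (inj₁ j) = n ∣? toℕ j
jahangirAdj? n m (inj₂ _) (inj₂ _) = no λ ()

adj? : ∀ u v → Dec (Adj J₂,₃ u v)
adj? u v = jahangirAdj? 2 3 (splitAt 6 u) (splitAt 6 v)

edge? : ∀ (u v : Vertex J₂,₃) → Dec ((u , v) ∈ edges ⊎ (v , u) ∈ edges)
edge? u v = ((u , v) ∈? edges) ⊎-dec ((v , u) ∈? edges)
  where open DecMembership (×-≡-dec Fin._≟_ Fin._≟_) using (_∈?_)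

-- `edges` lists each edge in one orientation, hence the disjunction. Both implications are decided
-- over all 49 pairs.
adj⇔edge : ∀ u v → Adj J₂,₃ u v ⇔ ((u , v) ∈ edges ⊎ (v , u) ∈ edges)
adj⇔edge u v = mk⇔
  (from-yes (all? λ u → all? λ v → adj? u v →-dec edge? u v) u v)
  (from-yes (all? λ u → all? λ v → edge? u v →-dec adj? u v) u v)

-- Eight pebbles suffice.

neighbours : Vertex J₂,₃ → List (Vertex J₂,₃)
neighbours = lookup
  ( (v₂ ∷ v₆ ∷ v₇ ∷ []) ∷ (v₁ ∷ v₃ ∷ []) ∷ (v₂ ∷ v₄ ∷ v₇ ∷ []) ∷ (v₃ ∷ v₅ ∷ [])
  ∷ (v₄ ∷ v₆ ∷ v₇ ∷ []) ∷ (v₁ ∷ v₅ ∷ []) ∷ (v₁ ∷ v₃ ∷ v₅ ∷ []) ∷ [])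

-- All vertices by increasing distance: trying first the moves that end near
-- the root makes the search backtrack little.
nearest : Vertex J₂,₃ → List (Vertex J₂,₃)
nearest = lookup
  ( (v₁ ∷ v₂ ∷ v₆ ∷ v₇ ∷ v₃ ∷ v₅ ∷ v₄ ∷ [])
  ∷ (v₂ ∷ v₁ ∷ v₃ ∷ v₄ ∷ v₆ ∷ v₇ ∷ v₅ ∷ [])
  ∷ (v₃ ∷ v₂ ∷ v₄ ∷ v₇ ∷ v₁ ∷ v₅ ∷ v₆ ∷ [])
  ∷ (v₄ ∷ v₃ ∷ v₅ ∷ v₂ ∷ v₆ ∷ v₇ ∷ v₁ ∷ [])
  ∷ (v₅ ∷ v₄ ∷ v₆ ∷ v₇ ∷ v₁ ∷ v₃ ∷ v₂ ∷ [])
  ∷ (v₆ ∷ v₁ ∷ v₅ ∷ v₂ ∷ v₄ ∷ v₇ ∷ v₃ ∷ [])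
  ∷ (v₇ ∷ v₁ ∷ v₃ ∷ v₅ ∷ v₂ ∷ v₄ ∷ v₆ ∷ []) ∷ [])

arcs : Vertex J₂,₃ → List (Vertex J₂,₃ × Vertex J₂,₃)
arcs w = concatMap (λ v → map (_, v) (neighbours v)) (nearest w)

arcs-adj : ∀ w → All (uncurry (Adj J₂,₃)) (arcs w)
arcs-adj = from-yes (all? λ w → All.all? (uncurry adj?) (arcs w))

solves : Vertex J₂,₃ → Distribution J₂,₃ → Bool
solves w = reaches J₂,₃ (arcs w) w 7

solves-all : all (λ w → all (solves w) (compositions 7 8)) (allFin 7) ≡ true
-- Evaluation runs the search on 3003 distributions for each of the seven roots.
solves-all = refl

eight-suffice : ∀ p → size J₂,₃ p ≡ 8 → ∀ w → Reachable J₂,₃ p w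
eight-suffice p |p|≡8 w = reaches-sound J₂,₃ (arcs w) w (arcs-adj w) 7 p
  (from T-≡ (all-sound-compositions (solves w) 8
    (all-sound (λ w → all (solves w) (compositions 7 8)) (allFin 7) solves-all (∈-allFin w))
    p |p|≡8))

-- Eight pebbles are needed.

ω : Vec ℕ 7
ω = 1 ∷ 2 ∷ 4 ∷ 8 ∷ 4 ∷ 2 ∷ 2 ∷ []

ω-doubling : ∀ u v → Adj J₂,₃ u v → lookup ω v ≤ 2 * lookup ω u
ω-doubling = from-yes (all? λ u → all? λ v → adj? u v →-dec (lookup ω v ≤? 2 * lookup ω u))

eight-needed : ∀ k → (∀ p → size J₂,₃ p ≡ k → ∀ w → Reachable J₂,₃ p w) → 8 ≤ k
eight-needed k reach = subst (8 ≤_) weight≡k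
  (reachable⇒≤weight J₂,₃ ω ω-doubling (reach k·v₁ (+-identityʳ k) v₄))
  where
  k·v₁ : Distribution J₂,₃
  k·v₁ = k ∷ 0 ∷ 0 ∷ 0 ∷ 0 ∷ 0 ∷ 0 ∷ []

  weight≡k : weight ω k·v₁ ≡ k
  weight≡k = begin
    -- The inner zero comes from unfolding `1 * k`, the outer one from the six empty vertices.
    k + 0 + 0 ≡⟨ +-identityʳ (k + 0) ⟩
    k + 0     ≡⟨ +-identityʳ k ⟩
    k         ∎
    where open ≡-Reasoning

pebblingNumber≡8 : IsPebblingNumber J₂,₃ 8
pebblingNumber≡8 = eight-suffice , eight-needed

-- Greedy moves towards `v₄`.

δ : Vertex J₂,₃ → ℕ
δ = lookup (3 ∷ 2 ∷ 1 ∷ 0 ∷ 1 ∷ 2 ∷ 2 ∷ [])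

-- This bounds the distance to `v₄` from below by `δ`, and `walk-to-v₄` bounds it from above.
δ-lipschitz : ∀ u v → Adj J₂,₃ u v → δ u ≤ suc (δ v)
δ-lipschitz = from-yes (all? λ u → all? λ v → adj? u v →-dec (δ u ≤? suc (δ v)))

walk-to-v₄ : ∀ u → Walk J₂,₃ u v₄ (δ u)
walk-to-v₄ = λ where
    zero                                     → step (from-yes (adj? v₁ v₂)) from-v₂
    (suc zero)                               → from-v₂
    (suc (suc zero))                         → from-v₃
    (suc (suc (suc zero)))                   → stop
    (suc (suc (suc (suc zero))))             → from-v₅
    (suc (suc (suc (suc (suc zero)))))       → step (from-yes (adj? v₆ v₅)) from-v₅
    (suc (suc (suc (suc (suc (suc zero)))))) → step (from-yes (adj? v₇ v₃)) from-v₃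
  where
  from-v₃ : Walk J₂,₃ v₃ v₄ 1
  from-v₃ = step (from-yes (adj? v₃ v₄)) stop

  from-v₅ : Walk J₂,₃ v₅ v₄ 1
  from-v₅ = step (from-yes (adj? v₅ v₄)) stop

  from-v₂ : Walk J₂,₃ v₂ v₄ 2
  from-v₂ = step (from-yes (adj? v₂ v₃)) from-v₃

-- The two available moves, `v₂` to `v₃` and `v₆` to `v₅`, are independent; the four entries record
-- which of them have been made.
greedy-orbit : List (Distribution J₂,₃)
greedy-orbit = p₀
             ∷ (1 ∷ 1 ∷ 1 ∷ 0 ∷ 0 ∷ 3 ∷ 1 ∷ [])
             ∷ (1 ∷ 3 ∷ 0 ∷ 0 ∷ 1 ∷ 1 ∷ 1 ∷ [])
             ∷ (1 ∷ 1 ∷ 1 ∷ 0 ∷ 1 ∷ 1 ∷ 1 ∷ [])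
             ∷ []

greedy-orbit-closed : ∀ {p q} → p ∈ greedy-orbit → GreedyMove J₂,₃ v₄ p q → q ∈ greedy-orbit
greedy-orbit-closed p∈ (move u v uv closer 2≤pu) =
  All.lookup (closed u v) p∈ uv
    (closer⇒δ< J₂,₃ v₄ δ refl δ-lipschitz walk-to-v₄ closer) 2≤pu
  where
  open DecMembership (Vec-≡-dec {n = 7} _≟_) using (_∈?_)

  -- With `Closer` weakened to `δ v < δ u`, every premise is decidable and closure becomes a finite
  -- check over pairs of vertices and the four entries.
  closed : ∀ u v → All (λ p → Adj J₂,₃ u v → δ v < δ u → 2 ≤ lookup p u →
                              pebble J₂,₃ u v p ∈ greedy-orbit) greedy-orbit
  closed = from-yes (all? λ u → all? λ v → All.all?
    (λ p → adj? u v →-dec ((δ v <? δ u) →-dec ((2 ≤? lookup p u) →-dec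
           (pebble J₂,₃ u v p ∈? greedy-orbit)))) greedy-orbit)

greedy-orbit-closed* : ∀ {p q} → p ∈ greedy-orbit → Star (GreedyMove J₂,₃ v₄) p q → q ∈ greedy-orbit
greedy-orbit-closed* p∈ ε        = p∈
greedy-orbit-closed* p∈ (m ◅ ms) = greedy-orbit-closed* (greedy-orbit-closed p∈ m) ms

greedy-orbit-misses-v₄ : All (λ p → lookup p v₄ < 1) greedy-orbit
greedy-orbit-misses-v₄ = from-yes (All.all? (λ p → lookup p v₄ <? 1) greedy-orbit)

p₀-not-greedily-reachable : ¬ GreedilyReachable J₂,₃ p₀ v₄
p₀-not-greedily-reachable (q , ms , 1≤qv₄) =
  <⇒≱ (All.lookup greedy-orbit-misses-v₄ (greedy-orbit-closed* (here refl) ms)) 1≤qv₄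

theorem2p3 : ¬ IsGreedy J₂,₃
    × (∀ u v → Adj J₂,₃ u v ⇔ ((u , v) ∈ edges ⊎ (v , u) ∈ edges))
    × IsPebblingNumber J₂,₃ 8
    × size J₂,₃ p₀ ≡ 8
    × ¬ GreedilyReachable J₂,₃ p₀ v₄
theorem2p3 =
    -- `IsGreedy` concerns only distributions whose size is the pebbling number, so `p₀` refutes it
    -- through `pebblingNumber≡8`.
    (λ greedy → p₀-not-greedily-reachable (greedy 8 pebblingNumber≡8 p₀ refl v₄))
  , adj⇔edge
  , pebblingNumber≡8
  , refl
  , p₀-not-greedily-reachable
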